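{- Let $G$ be a finite simple graph with independence number $\alpha(G)$, and let each edge of $G$ be coloured red or blue. Then there exists a covering set for $G$ consisting of at most $\alpha(G)$ monochromatic subgraphs, each of which has diameter at most $8\alpha(G)^2+12\alpha(G)+4$.
   Context: A 2-colouring of the edges of $G$ assigns each edge one of the two colours red and blue. A monochromatic subgraph is a subgraph of $G$ all of whose edges have the same colour; its diameter is measured within that subgraph (the maximum distance between two of its vertices using only its edges). A set $S$ of monochromatic subgraphs is a covering set for $G$ if $V(G)$ is contained in the union of the vertex sets of the members of $S$. $\alpha(G)$ is the maximum size of an independent set of vertices in $G$. -}

module Defs where

open import Data.Nat using (ℕ; zero; suc; _+_; _*_; _≤_; _^_)
open import Data.Bool using (Bool; true; false)
open import Data.Fin using (Fin)
open import Data.Fin.Subset using (Subset; _∈_; ∣_∣)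
open import Data.List using (List; length)
open import Data.List.Relation.Unary.Any using (Any)
open import Data.Product using (Σ; ∃; _×_; _,_)
open import Relation.Binary.PropositionalEquality using (_≡_)
open import Relation.Nullary using (¬_)

record Graph (n : ℕ) : Set where
  field
    adj     : Fin n → Fin n → Bool
    adj-sym : ∀ u v → adj u v ≡ adj v u
    adj-irr : ∀ u → adj u u ≡ false

open Graph public

Edge : ∀ {n} → Graph n → Fin n → Fin n → Set
Edge G u v = adj G u v ≡ true

data Colour : Set where
  red blue : Colour

-- A 2-colouring of the edges: a symmetric colour assignment to vertex pairs
-- (its values on non-edges are irrelevant).
record Colouring {n : ℕ} (G : Graph n) : Set where
  field
    col     : Fin n → Fin n → Colour
    col-sym : ∀ u v → col u v ≡ col v u

open Colouring public

Independent : ∀ {n} → Graph n → Subset n → Set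
Independent G S = ∀ u v → u ∈ S → v ∈ S → ¬ Edge G u v

IsIndependenceNumber : ∀ {n} → Graph n → ℕ → Set
IsIndependenceNumber {n} G a =
  (Σ (Subset n) λ S → Independent G S × ∣ S ∣ ≡ a) ×
  (∀ (S : Subset n) → Independent G S → ∣ S ∣ ≤ a)

record MonoSubgraph {n : ℕ} (G : Graph n) (c : Colouring G) : Set where
  field
    colour   : Colour
    verts    : Subset n
    edges    : Fin n → Fin n → Bool
    edges-sym : ∀ u v → edges u v ≡ edges v u
    edges-ok : ∀ u v → edges u v ≡ true →
               Edge G u v × col c u v ≡ colour × u ∈ verts × v ∈ verts

open MonoSubgraph public

data Walk {n : ℕ} {G : Graph n} {c : Colouring G} (H : MonoSubgraph G c)
     : Fin n → Fin n → ℕ → Set where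
  here : ∀ {u} → Walk H u u zero
  step : ∀ {u w v ℓ} → edges H u w ≡ true → Walk H w v ℓ → Walk H u v (suc ℓ)

DistLe : ∀ {n} {G : Graph n} {c : Colouring G} → MonoSubgraph G c →
         Fin n → Fin n → ℕ → Set
DistLe H u v D = ∃ λ ℓ → ℓ ≤ D × Walk H u v ℓ

-- diam(H) ≤ D (measured inside H; in particular H is connected)
DiamLe : ∀ {n} {G : Graph n} {c : Colouring G} → MonoSubgraph G c → ℕ → Set
DiamLe H D = ∀ u v → u ∈ verts H → v ∈ verts H → DistLe H u v D

Covers : ∀ {n} {G : Graph n} {c : Colouring G} → List (MonoSubgraph G c) → Set
Covers {n} Hs = ∀ (v : Fin n) → Any (λ H → v ∈ verts H) Hs

{-# OPTIONS --safe #-}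

-- Fix r = 4α² + 6α + 2 and induct on an upper bound b ≤ α for the independence number of the induced
-- subgraph on U; every covering set produced is a monochromatic ball of radius r.
--
-- If in both colours no two vertices of U are at distance exactly r + 1, then the balls of radius r are the
-- monochromatic components. View a vertex as an edge joining its red to its blue component: a matching is
-- an independent set, so König's theorem gives a cover by at most b components.
--
-- Otherwise take the BFS layers 3, 6, 9, … of one colour, say red, along a distance of r + 1: choosing a vertex
-- in each gives a set Q of α² + 1 vertices at pairwise red distance greater than 2. Let I be a maximum
-- independent subset of Q. Every vertex of Q is in I or a blue neighbour of I. Remove from U the blue balls around I.
-- If the rest has independence number at most b − |I|, apply induction to it. If not, it contains an
-- independent set J with |I| + |J| > b. There are no blue edges from J to Q, and each vertex of J has at most
-- one red neighbour in Q, so deleting the at most α red neighbours of J from Q leaves a set of smaller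
-- independence number, since an independent subset of size |I| could be joined to J. Repeat with that set;
-- Q is too large to be exhausted in this way.

module Submission where

open import Defs

open import Data.Bool using (Bool; true; false; if_then_else_)
open import Data.Bool.Properties using () renaming (_≟_ to _≟ᵇ_)
open import Data.Empty using (⊥-elim)
open import Data.Fin using (Fin; zero; suc; _≟_)
open import Data.Fin.Properties using (any?; all?; ¬Fin0)
open import Data.Fin.Subset using (Subset; inside; outside; _∈_; _∉_; _⊆_; _∪_; _∩_; _-_; ⁅_⁆; ⊤; ⊥; ∣_∣)
open import Data.Fin.Subset.Properties
open import Data.List using (List; []; _∷_; _++_; length)
open import Data.List.Properties using (length-++)
open import Data.List.Relation.Unary.All using (All; []; _∷_)
open import Data.List.Relation.Unary.All.Properties using () renaming (++⁺ to All-++⁺)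
open import Data.List.Relation.Unary.Any using (Any; here; there)
open import Data.List.Relation.Unary.Any.Properties using () renaming (++⁺ˡ to Any-++⁺ˡ; ++⁺ʳ to Any-++⁺ʳ)
open import Data.Nat using (ℕ; zero; suc; _+_; _*_; _∸_; _≤_; _<_; z≤n; s≤s; _≤?_)
open import Data.Nat.Properties hiding (_≟_)
open import Data.Nat.Induction using (<-wellFounded)
open import Data.Nat.Solver using (module +-*-Solver)
open import Data.Product using (Σ; ∃; ∃₂; _×_; _,_; proj₁; proj₂)
open import Data.Sum using (_⊎_; inj₁; inj₂; swap)
open import Data.Vec using ([]; _∷_; tabulate; here; there)
open import Data.Vec.Properties using (lookup∘tabulate; []=⇒lookup; lookup⇒[]=)
open import Function using (_∘_; mk⇔)
open import Induction.WellFounded using (Acc; acc)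
open import Relation.Binary.PropositionalEquality
open import Relation.Nullary using (¬_; Dec; yes; no; does; contradiction)
open import Relation.Nullary.Decidable using (dec-true; does-⇔; decidable-stable; _×-dec_; _⊎-dec_; _→-dec_; ¬?)
open import Relation.Unary using (Decidable)

private
  variable
    m n : ℕ

-- Decidable subsets of `Fin n` and their cardinalities

does⇒holds : ∀ {p} {P : Set p} (P? : Dec P) → does P? ≡ true → P
does⇒holds (yes p) _ = p

⟪_⟫ : {P : Fin n → Set} → Decidable P → Subset n
⟪ P? ⟫ = tabulate (does ∘ P?)

module _ {P : Fin n → Set} (P? : Decidable P) where

  ∈⟪⟫⁺ : ∀ {x} → P x → x ∈ ⟪ P? ⟫
  ∈⟪⟫⁺ {x} px = lookup⇒[]= x _ (trans (lookup∘tabulate (does ∘ P?) x) (dec-true (P? x) px))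

  ∈⟪⟫⁻ : ∀ {x} → x ∈ ⟪ P? ⟫ → P x
  ∈⟪⟫⁻ {x} x∈ = does⇒holds (P? x) (trans (sym (lookup∘tabulate (does ∘ P?) x)) ([]=⇒lookup x∈))

∣p∪q∣+∣p∩q∣≡∣p∣+∣q∣ : (p q : Subset n) → ∣ p ∪ q ∣ + ∣ p ∩ q ∣ ≡ ∣ p ∣ + ∣ q ∣
∣p∪q∣+∣p∩q∣≡∣p∣+∣q∣ [] [] = refl
∣p∪q∣+∣p∩q∣≡∣p∣+∣q∣ (outside ∷ p) (outside ∷ q) = ∣p∪q∣+∣p∩q∣≡∣p∣+∣q∣ p q
∣p∪q∣+∣p∩q∣≡∣p∣+∣q∣ (inside ∷ p) (outside ∷ q) = cong suc (∣p∪q∣+∣p∩q∣≡∣p∣+∣q∣ p q)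
∣p∪q∣+∣p∩q∣≡∣p∣+∣q∣ (outside ∷ p) (inside ∷ q) =
  trans (cong suc (∣p∪q∣+∣p∩q∣≡∣p∣+∣q∣ p q)) (sym (+-suc ∣ p ∣ ∣ q ∣))
∣p∪q∣+∣p∩q∣≡∣p∣+∣q∣ (inside ∷ p) (inside ∷ q) = cong suc
  (trans (+-suc ∣ p ∪ q ∣ ∣ p ∩ q ∣)
         (trans (cong suc (∣p∪q∣+∣p∩q∣≡∣p∣+∣q∣ p q)) (sym (+-suc ∣ p ∣ ∣ q ∣))))

∣p∪q∣≤∣p∣+∣q∣ : (p q : Subset n) → ∣ p ∪ q ∣ ≤ ∣ p ∣ + ∣ q ∣
∣p∪q∣≤∣p∣+∣q∣ p q = ≤-trans (m≤m+n _ _) (≤-reflexive (∣p∪q∣+∣p∩q∣≡∣p∣+∣q∣ p q))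

∣p∪⁅x⁆∣≤1+∣p∣ : (p : Subset n) (x : Fin n) → ∣ p ∪ ⁅ x ⁆ ∣ ≤ suc ∣ p ∣
∣p∪⁅x⁆∣≤1+∣p∣ p x = ≤-trans (∣p∪q∣≤∣p∣+∣q∣ p ⁅ x ⁆)
  (≤-reflexive (trans (cong (∣ p ∣ +_) (∣⁅x⁆∣≡1 x)) (+-comm ∣ p ∣ 1)))

empty⇒∣p∣≡0 : {p : Subset n} → (∀ x → x ∉ p) → ∣ p ∣ ≡ 0
empty⇒∣p∣≡0 {n} ∅ = trans (cong ∣_∣ (Empty-unique (λ (x , x∈p) → ∅ x x∈p))) (∣⊥∣≡0 n)

disjoint⇒∣p∪q∣≡∣p∣+∣q∣ : (p q : Subset n) → (∀ x → x ∈ p → x ∉ q) → ∣ p ∪ q ∣ ≡ ∣ p ∣ + ∣ q ∣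
disjoint⇒∣p∪q∣≡∣p∣+∣q∣ p q dis = begin
  ∣ p ∪ q ∣                ≡⟨ +-identityʳ _ ⟨
  ∣ p ∪ q ∣ + 0            ≡⟨ cong (∣ p ∪ q ∣ +_) (empty⇒∣p∣≡0 λ x x∈ → let x∈p , x∈q = x∈p∩q⁻ p q x∈ in dis x x∈p x∈q) ⟨
  ∣ p ∪ q ∣ + ∣ p ∩ q ∣    ≡⟨ ∣p∪q∣+∣p∩q∣≡∣p∣+∣q∣ p q ⟩
  ∣ p ∣ + ∣ q ∣            ∎
  where open ≡-Reasoning

x∉p⇒∣p∪⁅x⁆∣≡1+∣p∣ : (p : Subset n) (x : Fin n) → x ∉ p → ∣ p ∪ ⁅ x ⁆ ∣ ≡ suc ∣ p ∣
x∉p⇒∣p∪⁅x⁆∣≡1+∣p∣ p x x∉p = trans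
  (disjoint⇒∣p∪q∣≡∣p∣+∣q∣ p ⁅ x ⁆ λ y y∈p y∈x → x∉p (subst (_∈ p) (x∈⁅y⁆⇒x≡y x y∈x) y∈p))
  (trans (cong (∣ p ∣ +_) (∣⁅x⁆∣≡1 x)) (+-comm ∣ p ∣ 1))

x∈p⇒x≡y⊎x∈p-y : {p : Subset n} {x : Fin n} (y : Fin n) → x ∈ p → x ≡ y ⊎ x ∈ p - y
x∈p⇒x≡y⊎x∈p-y {x = x} y x∈p with x ≟ y
... | yes x≡y = inj₁ x≡y
... | no x≢y = inj₂ (x∈p∧x≢y⇒x∈p-y x∈p x≢y)

∣p∣≤1+∣p-x∣ : (p : Subset n) (x : Fin n) → ∣ p ∣ ≤ suc ∣ p - x ∣
∣p∣≤1+∣p-x∣ p x = ≤-trans (p⊆q⇒∣p∣≤∣q∣ p⊆) (∣p∪⁅x⁆∣≤1+∣p∣ (p - x) x)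
  where
  p⊆ : p ⊆ (p - x) ∪ ⁅ x ⁆
  p⊆ y∈p with x∈p⇒x≡y⊎x∈p-y x y∈p
  ... | inj₁ refl = x∈p∪q⁺ (inj₂ (x∈⁅x⁆ x))
  ... | inj₂ y∈ = x∈p∪q⁺ (inj₁ y∈)

-- Induction on `S`: its first member is related to at most one member of `T`, and the two are
-- deleted together. A relation is used since one application takes `ρ` to be adjacency in a graph.
functional⇒∣T∣≤∣S∣ : (S : Subset m) (T : Subset n) {ρ : Fin m → Fin n → Set} →
  (∀ s t → Dec (ρ s t)) →
  (∀ {t} → t ∈ T → ∃ λ s → s ∈ S × ρ s t) →
  (∀ {s t t′} → t ∈ T → t′ ∈ T → ρ s t → ρ s t′ → t ≡ t′) →
  ∣ T ∣ ≤ ∣ S ∣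
functional⇒∣T∣≤∣S∣ [] T ρ? onto fun = ≤-reflexive (empty⇒∣p∣≡0 λ t t∈ → ¬Fin0 (proj₁ (onto t∈)))
functional⇒∣T∣≤∣S∣ (outside ∷ S) T {ρ} ρ? onto fun =
  functional⇒∣T∣≤∣S∣ S T (ρ? ∘ suc) (drop-zero ∘ onto) fun
  where
  drop-zero : ∀ {t} → (∃ λ s → s ∈ outside ∷ S × ρ s t) → ∃ λ s → s ∈ S × ρ (suc s) t
  drop-zero (suc s , there s∈ , r) = s , s∈ , r
functional⇒∣T∣≤∣S∣ (inside ∷ S) T {ρ} ρ? onto fun with any? (λ t → t ∈? T ×-dec ρ? zero t)
... | no ¬t₀ = m≤n⇒m≤1+n (functional⇒∣T∣≤∣S∣ S T (ρ? ∘ suc) onto′ fun)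
  where
  onto′ : ∀ {t} → t ∈ T → ∃ λ s → s ∈ S × ρ (suc s) t
  onto′ {t} t∈ with onto t∈
  ... | zero , _ , r = contradiction (t , t∈ , r) ¬t₀
  ... | suc s , there s∈ , r = s , s∈ , r
... | yes (t₀ , t₀∈ , r₀) = ≤-trans (∣p∣≤1+∣p-x∣ T t₀)
  (s≤s (functional⇒∣T∣≤∣S∣ S (T - t₀) (ρ? ∘ suc) onto′ λ t∈ t′∈ → fun (⊆T t∈) (⊆T t′∈)))
  where
  ⊆T : T - t₀ ⊆ T
  ⊆T = p─q⊆p T ⁅ t₀ ⁆
  onto′ : ∀ {t} → t ∈ T - t₀ → ∃ λ s → s ∈ S × ρ (suc s) t
  onto′ {t} t∈ with onto (⊆T t∈)
  ... | suc s , there s∈ , r = s , s∈ , r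
  ... | zero , _ , r with fun (⊆T t∈) t₀∈ r r₀
  ... | refl = contradiction t∈ (x∉p-x T t)
    where
    x∉p-x : ∀ {n} (p : Subset n) x → x ∉ p - x
    x∉p-x (inside ∷ p) zero ()
    x∉p-x (outside ∷ p) zero ()
    x∉p-x (_ ∷ p) (suc x) (there x∈) = x∉p-x p x x∈

-- Lists indexed by subsets

module _ {A : Set} where

  image : (Fin n → A) → Subset n → List A
  image F [] = []
  image F (outside ∷ p) = image (F ∘ suc) p
  image F (inside ∷ p) = F zero ∷ image (F ∘ suc) p

  length-image : (F : Fin n → A) (p : Subset n) → length (image F p) ≡ ∣ p ∣
  length-image F [] = refl
  length-image F (outside ∷ p) = length-image (F ∘ suc) p
  length-image F (inside ∷ p) = cong suc (length-image (F ∘ suc) p)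

  All-image⁺ : {Q : A → Set} (F : Fin n → A) (p : Subset n) → (∀ x → Q (F x)) → All Q (image F p)
  All-image⁺ F [] q = []
  All-image⁺ F (outside ∷ p) q = All-image⁺ (F ∘ suc) p (q ∘ suc)
  All-image⁺ F (inside ∷ p) q = q zero ∷ All-image⁺ (F ∘ suc) p (q ∘ suc)

  Any-image⁺ : {Q : A → Set} (F : Fin n → A) {p : Subset n} {x : Fin n} → x ∈ p → Q (F x) → Any Q (image F p)
  Any-image⁺ F {inside ∷ p} {zero} here q = here q
  Any-image⁺ F {inside ∷ p} {suc x} (there x∈) q = there (Any-image⁺ (F ∘ suc) x∈ q)
  Any-image⁺ F {outside ∷ p} {suc x} (there x∈) q = Any-image⁺ (F ∘ suc) x∈ q

-- Least witnesses of a Boolean predicate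

least : (Fin n → Bool) → Fin n → Fin n
least P zero = zero
least P (suc i) = if P zero then zero else suc (least (P ∘ suc) i)

least-holds : (P : Fin n → Bool) {i : Fin n} → P i ≡ true → P (least P i) ≡ true
least-holds P {zero} pi = pi
least-holds P {suc i} pi with P zero in p₀
... | true = p₀
... | false = least-holds (P ∘ suc) pi

-- If the predicate holds at the start of the search, the result is its overall minimum, so the
-- start does not matter. This makes `least` a source of canonical representatives.
least-cong : {P P′ : Fin n → Bool} → P ≗ P′ → ∀ {i j} → P i ≡ true → P j ≡ true → least P i ≡ least P′ j
least-cong P≗ {zero} {zero} pi pj = refl
least-cong P≗ {zero} {suc j} pi pj rewrite sym (P≗ zero) | pi = refl
least-cong P≗ {suc i} {zero} pi pj rewrite pj = refl
least-cong {P = P} P≗ {suc i} {suc j} pi pj rewrite sym (P≗ zero) with P zero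
... | true = refl
... | false = cong suc (least-cong (P≗ ∘ suc) pi pj)

-- König's theorem

-- Each v ∈ E is regarded as an edge joining f v to g v in a bipartite multigraph.

module _ (f g : Fin n → Fin m) where

  Matching : Subset n → Set
  Matching M = ∀ {u v} → u ∈ M → v ∈ M → u ≢ v → f u ≢ f v × g u ≢ g v

  Touches : Subset m → Subset m → Fin n → Set
  Touches A B v = f v ∈ A ⊎ g v ∈ B

  VertexCover : Subset n → ℕ → Set
  VertexCover E t = ∃₂ λ A B → ∣ A ∣ + ∣ B ∣ ≤ t × (∀ {v} → v ∈ E → Touches A B v)

  touches? : ∀ A B → Decidable (Touches A B)
  touches? A B v = f v ∈? A ⊎-dec g v ∈? B

  reinsert : ∀ {E A B} e → (∀ {v} → v ∈ E - e → Touches A B v) → Touches A B e → ∀ {v} → v ∈ E → Touches A B v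
  reinsert e cov te v∈ with x∈p⇒x≡y⊎x∈p-y e v∈
  ... | inj₁ refl = te
  ... | inj₂ v∈′ = cov v∈′

  image-cover : ∀ E → VertexCover E ∣ E ∣
  image-cover E = A , ⊥ , bound , λ v∈ → inj₁ (∈⟪⟫⁺ A? (_ , v∈ , refl))
    where
    A? : Decidable (λ a → ∃ λ v → v ∈ E × f v ≡ a)
    A? a = any? λ v → v ∈? E ×-dec f v ≟ a
    A : Subset m
    A = ⟪ A? ⟫
    bound : ∣ A ∣ + ∣ ⊥ {m} ∣ ≤ ∣ E ∣
    bound rewrite ∣⊥∣≡0 m | +-identityʳ ∣ A ∣ =
      functional⇒∣T∣≤∣S∣ E A (λ v a → f v ≟ a) (∈⟪⟫⁻ A?) λ _ _ → λ where refl refl → refl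

  -- If neither cover touches the edge it was allowed to miss, then uncrossing them on the two sides
  -- gives two covers of E of total size at most 2t + 1.
  uncross : ∀ {E t e₁ e₂} → e₁ ∈ E → e₂ ∈ E → e₁ ≢ e₂ → f e₁ ≡ f e₂ →
    VertexCover (E - e₁) t → VertexCover (E - e₂) t → VertexCover E t
  uncross {E} {t} {e₁} {e₂} e₁∈ e₂∈ e₁≢e₂ fe₁≡fe₂ (A₁ , B₁ , ≤₁ , cov₁) (A₂ , B₂ , ≤₂ , cov₂)
    with touches? A₁ B₁ e₁ | touches? A₂ B₂ e₂
  ... | yes t₁ | _ = A₁ , B₁ , ≤₁ , reinsert e₁ cov₁ t₁
  ... | no _ | yes t₂ = A₂ , B₂ , ≤₂ , reinsert e₂ cov₂ t₂
  ... | no ¬t₁ | no ¬t₂ = choose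
    where
    -- `e₁` survives in `E - e₂`, so the second cover touches it. It cannot do so at the shared
    -- `f`-endpoint, since it misses `e₂`.
    ge₁∈B₂ : g e₁ ∈ B₂
    ge₁∈B₂ with cov₂ (x∈p∧x≢y⇒x∈p-y e₁∈ e₁≢e₂)
    ... | inj₁ fe₁∈ = contradiction (inj₁ (subst (_∈ A₂) fe₁≡fe₂ fe₁∈)) ¬t₂
    ... | inj₂ ge₁∈ = ge₁∈
    ge₂∈B₁ : g e₂ ∈ B₁
    ge₂∈B₁ with cov₁ (x∈p∧x≢y⇒x∈p-y e₂∈ (e₁≢e₂ ∘ sym))
    ... | inj₁ fe₂∈ = contradiction (inj₁ (subst (_∈ A₁) (sym fe₁≡fe₂) fe₂∈)) ¬t₁
    ... | inj₂ ge₂∈ = ge₂∈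

    A′ B′ A″ B″ : Subset m
    A′ = A₁ ∩ A₂
    B′ = B₁ ∪ B₂
    A″ = (A₁ ∪ A₂) ∪ ⁅ f e₁ ⁆
    B″ = B₁ ∩ B₂

    split : ∀ {v} → v ∈ E → v ≡ e₁ ⊎ v ≡ e₂ ⊎ (Touches A₁ B₁ v × Touches A₂ B₂ v)
    split v∈ with x∈p⇒x≡y⊎x∈p-y e₁ v∈ | x∈p⇒x≡y⊎x∈p-y e₂ v∈
    ... | inj₁ p | _ = inj₁ p
    ... | inj₂ _ | inj₁ q = inj₂ (inj₁ q)
    ... | inj₂ v∈₁ | inj₂ v∈₂ = inj₂ (inj₂ (cov₁ v∈₁ , cov₂ v∈₂))

    cov′ : ∀ {v} → v ∈ E → Touches A′ B′ v
    cov′ v∈ with split v∈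
    ... | inj₁ refl = inj₂ (x∈p∪q⁺ (inj₂ ge₁∈B₂))
    ... | inj₂ (inj₁ refl) = inj₂ (x∈p∪q⁺ (inj₁ ge₂∈B₁))
    ... | inj₂ (inj₂ (inj₁ p , inj₁ q)) = inj₁ (x∈p∩q⁺ (p , q))
    ... | inj₂ (inj₂ (inj₂ p , _)) = inj₂ (x∈p∪q⁺ (inj₁ p))
    ... | inj₂ (inj₂ (_ , inj₂ q)) = inj₂ (x∈p∪q⁺ (inj₂ q))

    cov″ : ∀ {v} → v ∈ E → Touches A″ B″ v
    cov″ v∈ with split v∈
    ... | inj₁ refl = inj₁ (x∈p∪q⁺ (inj₂ (x∈⁅x⁆ _)))
    ... | inj₂ (inj₁ refl) = inj₁ (x∈p∪q⁺ (inj₂ (subst (_∈ ⁅ f e₁ ⁆) fe₁≡fe₂ (x∈⁅x⁆ _))))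
    ... | inj₂ (inj₂ (inj₂ p , inj₂ q)) = inj₂ (x∈p∩q⁺ (p , q))
    ... | inj₂ (inj₂ (inj₁ p , _)) = inj₁ (x∈p∪q⁺ (inj₁ (x∈p∪q⁺ (inj₁ p))))
    ... | inj₂ (inj₂ (_ , inj₁ q)) = inj₁ (x∈p∪q⁺ (inj₁ (x∈p∪q⁺ (inj₂ q))))

    total : (∣ A′ ∣ + ∣ B′ ∣) + (∣ A₁ ∪ A₂ ∣ + ∣ B″ ∣) ≤ t + t
    total = begin
      (∣ A′ ∣ + ∣ B′ ∣) + (∣ A₁ ∪ A₂ ∣ + ∣ B″ ∣)  ≡⟨ regroup (∣ A′ ∣) (∣ B′ ∣) (∣ A₁ ∪ A₂ ∣) (∣ B″ ∣) ⟩
      (∣ A₁ ∪ A₂ ∣ + ∣ A′ ∣) + (∣ B′ ∣ + ∣ B″ ∣)  ≡⟨ cong₂ _+_ (∣p∪q∣+∣p∩q∣≡∣p∣+∣q∣ A₁ A₂) (∣p∪q∣+∣p∩q∣≡∣p∣+∣q∣ B₁ B₂) ⟩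
      (∣ A₁ ∣ + ∣ A₂ ∣) + (∣ B₁ ∣ + ∣ B₂ ∣)       ≡⟨ interchange (∣ A₁ ∣) (∣ A₂ ∣) (∣ B₁ ∣) (∣ B₂ ∣) ⟩
      (∣ A₁ ∣ + ∣ B₁ ∣) + (∣ A₂ ∣ + ∣ B₂ ∣)       ≤⟨ +-mono-≤ ≤₁ ≤₂ ⟩
      t + t                                       ∎
      where
      open ≤-Reasoning
      open +-*-Solver
      regroup : ∀ a b c d → (a + b) + (c + d) ≡ (c + a) + (b + d)
      regroup = solve 4 (λ a b c d → (a :+ b) :+ (c :+ d) := (c :+ a) :+ (b :+ d)) refl
      interchange : ∀ a b c d → (a + b) + (c + d) ≡ (a + c) + (b + d)
      interchange = solve 4 (λ a b c d → (a :+ b) :+ (c :+ d) := (a :+ c) :+ (b :+ d)) refl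

    choose : VertexCover E t
    choose with ∣ A′ ∣ + ∣ B′ ∣ ≤? t
    ... | yes small = A′ , B′ , small , cov′
    ... | no ¬small = A″ , B″ , small″ , cov″
      where
      open ≤-Reasoning
      -- The extra endpoint `f e₁` raises the combined size to at most `2t + 1`; the first cover has
      -- more than `t`, which leaves `t` for the second.
      small″ : ∣ A″ ∣ + ∣ B″ ∣ ≤ t
      small″ = +-cancelˡ-≤ t _ _ (begin
        t + (∣ A″ ∣ + ∣ B″ ∣)                       ≤⟨ +-monoʳ-≤ t (+-monoˡ-≤ (∣ B″ ∣) (∣p∪⁅x⁆∣≤1+∣p∣ (A₁ ∪ A₂) (f e₁))) ⟩
        t + suc (∣ A₁ ∪ A₂ ∣ + ∣ B″ ∣)              ≡⟨ +-suc t _ ⟩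
        suc t + (∣ A₁ ∪ A₂ ∣ + ∣ B″ ∣)              ≤⟨ +-monoˡ-≤ (∣ A₁ ∪ A₂ ∣ + ∣ B″ ∣) (≰⇒> ¬small) ⟩
        (∣ A′ ∣ + ∣ B′ ∣) + (∣ A₁ ∪ A₂ ∣ + ∣ B″ ∣)  ≤⟨ total ⟩
        t + t                                       ∎)

swap-cover : ∀ {f g : Fin n → Fin m} {E t} → VertexCover f g E t → VertexCover g f E t
swap-cover (A , B , ≤t , cov) = B , A , ≤-trans (≤-reflexive (+-comm (∣ B ∣) (∣ A ∣))) ≤t , swap ∘ cov

-- Strong induction on the size of `E`. If two edges clash, delete each in turn: a large matching
-- found in either case is also one in `E`, and two small covers can be uncrossed. Without clashes
-- `E` is itself a matching, and one endpoint per edge is a cover.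
könig : (f g : Fin n → Fin m) (E : Subset n) (t : ℕ) →
  VertexCover f g E t ⊎ ∃ λ M → M ⊆ E × Matching f g M × t < ∣ M ∣
könig {n} f g E t = go E (<-wellFounded ∣ E ∣)
  where
  Result : Subset n → Set
  Result E = VertexCover f g E t ⊎ ∃ λ M → M ⊆ E × Matching f g M × t < ∣ M ∣

  Clash : Subset n → Fin n → Fin n → Set
  Clash E u v = u ∈ E × v ∈ E × u ≢ v × (f u ≡ f v ⊎ g u ≡ g v)

  clash? : ∀ E u v → Dec (Clash E u v)
  clash? E u v = u ∈? E ×-dec v ∈? E ×-dec ¬? (u ≟ v) ×-dec (f u ≟ f v ⊎-dec g u ≟ g v)

  widen : ∀ {E e} → (∃ λ M → M ⊆ E - e × Matching f g M × t < ∣ M ∣) → Result E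
  widen {E} {e} (M , M⊆ , rest) = inj₂ (M , p─q⊆p E ⁅ e ⁆ ∘ M⊆ , rest)

  go : ∀ E → Acc _<_ ∣ E ∣ → Result E
  go E (acc rs) with any? (λ u → any? (clash? E u))
  ... | yes (e₁ , e₂ , e₁∈ , e₂∈ , e₁≢e₂ , clash)
    with go (E - e₁) (rs (x∈p⇒∣p-x∣<∣p∣ e₁∈)) | go (E - e₂) (rs (x∈p⇒∣p-x∣<∣p∣ e₂∈)) | clash
  ... | inj₂ M | _ | _ = widen M
  ... | inj₁ _ | inj₂ M | _ = widen M
  ... | inj₁ C₁ | inj₁ C₂ | inj₁ f≡ = inj₁ (uncross f g e₁∈ e₂∈ e₁≢e₂ f≡ C₁ C₂)
  ... | inj₁ C₁ | inj₁ C₂ | inj₂ g≡ =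
    inj₁ (swap-cover (uncross g f e₁∈ e₂∈ e₁≢e₂ g≡ (swap-cover C₁) (swap-cover C₂)))
  go E (acc rs) | no ¬clash with ∣ E ∣ ≤? t
  ... | no ∣E∣≰t = inj₂ (E , (λ x∈ → x∈) , matching , ≰⇒> ∣E∣≰t)
    where
    matching : Matching f g E
    matching u∈ v∈ u≢v =
      (λ f≡ → ¬clash (_ , _ , u∈ , v∈ , u≢v , inj₁ f≡)) ,
      (λ g≡ → ¬clash (_ , _ , u∈ , v∈ , u≢v , inj₂ g≡))
  ... | yes ∣E∣≤t with image-cover f g E
  ... | A , B , ≤E , cov = inj₁ (A , B , ≤-trans ≤E ∣E∣≤t , cov)

-- Distances, BFS layers and scattered sets

module Distance (R : Fin n → Fin n → Set) where

  Within : ℕ → Fin n → Fin n → Set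
  Within zero u v = u ≡ v
  Within (suc d) u v = Within d u v ⊎ ∃ λ w → Within d u w × R w v

  Layer : ℕ → Fin n → Fin n → Set
  Layer i u v = Within i u v × (∀ {j} → j < i → ¬ Within j u v)

  within-refl : ∀ d {u} → Within d u u
  within-refl zero = refl
  within-refl (suc d) = inj₁ (within-refl d)

  within-edge : ∀ {u v} → R u v → Within 1 u v
  within-edge r = inj₂ (_ , refl , r)

  within-trans : ∀ {d u v} e {w} → Within d u v → Within e v w → Within (d + e) u w
  within-trans {d} zero p refl rewrite +-identityʳ d = p
  within-trans {d} (suc e) p (inj₁ q) rewrite +-suc d e = inj₁ (within-trans e p q)
  within-trans {d} (suc e) p (inj₂ (x , q , r)) rewrite +-suc d e = inj₂ (x , within-trans e p q , r)

  within-mono : ∀ {d e u v} → d ≤ e → Within d u v → Within e u v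
  within-mono {d} {e} d≤e p = subst (λ k → Within k _ _) (m+[n∸m]≡n d≤e) (within-trans (e ∸ d) p (within-refl (e ∸ d)))

  -- Along a longer walk, every prefix is shortened to `d` before the next edge is appended, so the
  -- length never exceeds `d + 1`.
  within-stable : ∀ {d} → (∀ {u v} → Within (suc d) u v → Within d u v) → ∀ e {u v} → Within e u v → Within d u v
  within-stable {d} st zero refl = within-refl d
  within-stable st (suc e) (inj₁ p) = within-stable st e p
  within-stable st (suc e) (inj₂ (w , p , r)) = st (inj₂ (w , within-stable st e p , r))

  layer-of-within : ∀ {d u v} → Within (suc d) u v → ¬ Within d u v → Layer (suc d) u v
  layer-of-within p ¬q = p , λ where (s≤s j≤d) q → ¬q (within-mono j≤d q)

  -- A shorter way to the predecessor would extend to a shorter way to `v`.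
  layer-pred : ∀ {i u v} → Layer (suc i) u v → ∃ λ w → Layer i u w × R w v
  layer-pred (inj₁ p , ¬q) = contradiction p (¬q ≤-refl)
  layer-pred (inj₂ (w , p , r) , ¬q) = w , (p , λ j<i q → ¬q (s≤s j<i) (inj₂ (w , q , r))) , r

  layer-below : ∀ k {i u v} → Layer (k + i) u v → ∃ (Layer i u)
  layer-below zero l = _ , l
  layer-below (suc k) l = layer-below k (proj₁ (proj₂ (layer-pred l)))

  module _ (R? : ∀ u v → Dec (R u v)) where

    within? : ∀ d u v → Dec (Within d u v)
    within? zero u v = u ≟ v
    within? (suc d) u v = within? d u v ⊎-dec any? (λ w → within? d u w ×-dec R? w v)

  module _ (R-sym : ∀ {u v} → R u v → R v u) where

    within-sym : ∀ d {u v} → Within d u v → Within d v u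
    within-sym zero refl = refl
    within-sym (suc d) (inj₁ p) = inj₁ (within-sym d p)
    within-sym (suc d) (inj₂ (w , p , r)) = within-trans d (within-edge (R-sym r)) (within-sym d p)

    Scattered : Subset n → Set
    Scattered Q = ∀ {p q} → p ∈ Q → q ∈ Q → Within 2 p q → p ≡ q

    -- One vertex is taken from each of the layers 3, 6, ..., `s * 3`. The recorded edge into `q`
    -- later shows that `q` belongs to the vertex set on which `R` lives.
    scattered-set : ∀ s {u v} → Layer (s * 3) u v → ∃ λ Q →
      (∀ {q} → q ∈ Q → Within (s * 3) u q × ∃ λ w → R w q) × Scattered Q × ∣ Q ∣ ≡ s
    scattered-set zero l = ⊥ , (λ q∈ → contradiction q∈ ∉⊥) , (λ p∈ → contradiction p∈ ∉⊥) , ∣⊥∣≡0 n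
    scattered-set (suc s) {u} {v} l@(uv , ¬near)
      with scattered-set s (proj₂ (layer-below 3 l)) | layer-pred l
    ... | Q , near , scattered , ∣Q∣≡s | w , _ , wv =
      Q ∪ ⁅ v ⁆ , near′ , scattered′ , trans (x∉p⇒∣p∪⁅x⁆∣≡1+∣p∣ Q v v∉Q) (cong suc ∣Q∣≡s)
      where
      -- `q` is within `3s` of `u`, so two more steps would reach `v` within `3s + 2`, although `v`
      -- is in layer `3s + 3`.
      far : ∀ {q} → q ∈ Q → ¬ Within 2 q v
      far q∈ qv = ¬near (s≤s (≤-reflexive (+-comm (s * 3) 2))) (within-trans 2 (proj₁ (near q∈)) qv)

      v∉Q : v ∉ Q
      v∉Q v∈ = far v∈ (within-refl 2)

      near′ : ∀ {q} → q ∈ Q ∪ ⁅ v ⁆ → Within (suc s * 3) u q × ∃ λ w → R w q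
      near′ q∈ with x∈p∪q⁻ Q ⁅ v ⁆ q∈
      ... | inj₁ q∈Q = within-mono (m≤n+m _ 3) (proj₁ (near q∈Q)) , proj₂ (near q∈Q)
      ... | inj₂ q∈v rewrite x∈⁅y⁆⇒x≡y v q∈v = uv , w , wv

      scattered′ : Scattered (Q ∪ ⁅ v ⁆)
      scattered′ p∈ q∈ pq with x∈p∪q⁻ Q ⁅ v ⁆ p∈ | x∈p∪q⁻ Q ⁅ v ⁆ q∈
      ... | inj₁ p∈Q | inj₁ q∈Q = scattered p∈Q q∈Q pq
      ... | inj₁ p∈Q | inj₂ q∈v rewrite x∈⁅y⁆⇒x≡y v q∈v = contradiction pq (far p∈Q)
      ... | inj₂ p∈v | inj₁ q∈Q rewrite x∈⁅y⁆⇒x≡y v p∈v = contradiction (within-sym 2 pq) (far q∈Q)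
      ... | inj₂ p∈v | inj₂ q∈v = trans (x∈⁅y⁆⇒x≡y v p∈v) (sym (x∈⁅y⁆⇒x≡y v q∈v))

-- Colours and walks

_≟ᶜ_ : (k l : Colour) → Dec (k ≡ l)
red ≟ᶜ red = yes refl
red ≟ᶜ blue = no λ ()
blue ≟ᶜ red = no λ ()
blue ≟ᶜ blue = yes refl

other : Colour → Colour
other red = blue
other blue = red

≡⊎≡other : ∀ k l → l ≡ k ⊎ l ≡ other k
≡⊎≡other red red = inj₁ refl
≡⊎≡other red blue = inj₂ refl
≡⊎≡other blue red = inj₂ refl
≡⊎≡other blue blue = inj₁ refl

module _ {n : ℕ} {G : Graph n} {c : Colouring G} {H : MonoSubgraph G c} where

  walk-++ : ∀ {u v w ℓ ℓ′} → Walk H u v ℓ → Walk H v w ℓ′ → Walk H u w (ℓ + ℓ′)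
  walk-++ here q = q
  walk-++ (step e p) q = step e (walk-++ p q)

  walk-reverse : ∀ {u v ℓ} → Walk H u v ℓ → Walk H v u ℓ
  walk-reverse here = here
  walk-reverse {u} {v} (step {w = w} {ℓ = ℓ} e p) =
    subst (Walk H v u) (+-comm ℓ 1) (walk-++ (walk-reverse p) (step (trans (edges-sym H w u) e) here))

-- Monochromatic balls and their diameter

module MonochromaticBalls {n : ℕ} (G : Graph n) (c : Colouring G) where

  Adj : Colour → Subset n → Fin n → Fin n → Set
  Adj k U u v = Edge G u v × col c u v ≡ k × u ∈ U × v ∈ U

  adj? : ∀ k U u v → Dec (Adj k U u v)
  adj? k U u v = adj G u v ≟ᵇ true ×-dec col c u v ≟ᶜ k ×-dec u ∈? U ×-dec v ∈? U

  edge-sym : ∀ {u v} → Edge G u v → Edge G v u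
  edge-sym {u} {v} e = trans (adj-sym G v u) e

  adjacent-sym : ∀ {k U u v} → Adj k U u v → Adj k U v u
  adjacent-sym {u = u} {v} (e , uv , u∈ , v∈) = edge-sym e , trans (col-sym c v u) uv , v∈ , u∈

  module _ (k : Colour) (U : Subset n) where
    open Distance (Adj k U) public using () renaming (Within to Near)

  module D {k : Colour} {U : Subset n} = Distance (Adj k U)

  near? : ∀ k U d u v → Dec (Near k U d u v)
  near? k U = D.within? (adj? k U)

  ball : Colour → Subset n → ℕ → Fin n → MonoSubgraph G c
  ball k U r y = record
    { colour = k
    ; verts = ⟪ near? k U r y ⟫
    ; edges = λ u v → does (edge? u v)
    ; edges-sym = λ u v → does-⇔ (mk⇔ flip flip) (edge? u v) (edge? v u)
    ; edges-ok = λ u v e → let (uv , k≡ , _) , u∈ , v∈ = does⇒holds (edge? u v) e in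
        uv , k≡ , ∈⟪⟫⁺ (near? k U r y) u∈ , ∈⟪⟫⁺ (near? k U r y) v∈
    }
    where
    BallEdge : Fin n → Fin n → Set
    BallEdge u v = Adj k U u v × Near k U r y u × Near k U r y v
    edge? : ∀ u v → Dec (BallEdge u v)
    edge? u v = adj? k U u v ×-dec near? k U r y u ×-dec near? k U r y v
    flip : ∀ {u v} → BallEdge u v → BallEdge v u
    flip (uv , u∈ , v∈) = adjacent-sym uv , v∈ , u∈

  module _ {k : Colour} {U : Subset n} {r : ℕ} {y : Fin n} where

    -- All vertices on a walk of length at most `d` from `y` are within `d ≤ r` of `y`, so the walk
    -- can be retraced inside the ball.
    dist-to-centre : ∀ {d v} → d ≤ r → Near k U d y v → DistLe (ball k U r y) v y d
    dist-to-centre {zero} _ refl = 0 , z≤n , here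
    dist-to-centre {suc d} d<r (inj₁ p) with dist-to-centre (<⇒≤ d<r) p
    ... | ℓ , ℓ≤d , walk = ℓ , m≤n⇒m≤1+n ℓ≤d , walk
    dist-to-centre {suc d} d<r p@(inj₂ (w , q , wv)) with dist-to-centre (<⇒≤ d<r) q
    ... | ℓ , ℓ≤d , walk = suc ℓ , s≤s ℓ≤d , step edge walk
      where
      edge = dec-true (adj? k U _ w ×-dec near? k U r y _ ×-dec near? k U r y w)
        (adjacent-sym wv , D.within-mono d<r p , D.within-mono (<⇒≤ d<r) q)

    ball-diam : DiamLe (ball k U r y) (r + r)
    ball-diam u v u∈ v∈
      with dist-to-centre ≤-refl (∈⟪⟫⁻ (near? k U r y) u∈) | dist-to-centre ≤-refl (∈⟪⟫⁻ (near? k U r y) v∈)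
    ... | ℓ , ℓ≤r , uy | ℓ′ , ℓ′≤r , vy = ℓ + ℓ′ , +-mono-≤ ℓ≤r ℓ′≤r , walk-++ uy (walk-reverse vy)

  -- Independent sets and coverings of a vertex subset

  IndependenceBound : Subset n → ℕ → Set
  IndependenceBound U b = ∀ {S} → S ⊆ U → Independent G S → ∣ S ∣ ≤ b

  independent? : ∀ S → Dec (Independent G S)
  independent? S = all? λ u → all? λ v → u ∈? S →-dec v ∈? S →-dec ¬? (adj G u v ≟ᵇ true)

  independence-dichotomy : ∀ U b → IndependenceBound U b ⊎ ∃ λ S → S ⊆ U × Independent G S × b < ∣ S ∣
  independence-dichotomy U b with anySubset? (λ S → S ⊆? U ×-dec independent? S ×-dec suc b ≤? ∣ S ∣)
  ... | yes S = inj₂ S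
  ... | no ¬S = inj₁ λ S⊆ ind → ≮⇒≥ λ b< → ¬S (_ , S⊆ , ind , b<)

  ∪-independent : ∀ {S T} → Independent G S → Independent G T →
    (∀ {u v} → u ∈ S → v ∈ T → ¬ Edge G u v) → Independent G (S ∪ T)
  ∪-independent {S} {T} indS indT cross u v u∈ v∈ e with x∈p∪q⁻ S T u∈ | x∈p∪q⁻ S T v∈
  ... | inj₁ u∈S | inj₁ v∈S = indS u v u∈S v∈S e
  ... | inj₁ u∈S | inj₂ v∈T = cross u∈S v∈T e
  ... | inj₂ u∈T | inj₁ v∈S = cross v∈S u∈T (edge-sym e)
  ... | inj₂ u∈T | inj₂ v∈T = indT u v u∈T v∈T e

  ⁅⁆-independent : ∀ x → Independent G ⁅ x ⁆
  ⁅⁆-independent x u v u∈ v∈ e rewrite x∈⁅y⁆⇒x≡y x u∈ | x∈⁅y⁆⇒x≡y x v∈ =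
    contradiction (trans (sym e) (adj-irr G x)) λ ()

  Covering : Subset n → ℕ → ℕ → Set
  Covering U b D = Σ (List (MonoSubgraph G c)) λ Hs →
    (∀ {v} → v ∈ U → Any (λ H → v ∈ verts H) Hs) × length Hs ≤ b × All (λ H → DiamLe H D) Hs

  -- The stable case: components and König's theorem

  module _ {U : Subset n} {r : ℕ} (stable : ∀ k {u v} → Near k U (suc r) u v → Near k U r u v) where

    -- By stability the ball of radius `r` around `v` is the whole component, so its least vertex
    -- names the component and can serve as the centre of a ball covering it.
    label : Colour → Fin n → Fin n
    label k v = least (λ w → does (near? k U r v w)) v

    near-label : ∀ k v → Near k U r (label k v) v
    near-label k v = D.within-sym adjacent-sym r (does⇒holds (near? k U r v _)
      (least-holds (λ w → does (near? k U r v w)) (dec-true (near? k U r v v) (D.within-refl r))))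

    label-cong : ∀ {k u v} → Adj k U u v → label k u ≡ label k v
    label-cong {k} {u} {v} uv = least-cong
      (λ w → does-⇔ (mk⇔ (move (adjacent-sym uv)) (move uv)) (near? k U r u w) (near? k U r v w))
      (dec-true (near? k U r u u) (D.within-refl r))
      (dec-true (near? k U r u v) (D.within-stable (stable k) 1 (D.within-edge uv)))
      where
      move : ∀ {u v w} → Adj k U u v → Near k U r v w → Near k U r u w
      move uv vw = stable k (D.within-trans r (D.within-edge uv) vw)

    component-covering : ∀ {b} → IndependenceBound U b → Covering U b (r + r)
    component-covering {b} bound with könig (label red) (label blue) U b
    ... | inj₂ (M , M⊆ , matching , b<) = contradiction (bound M⊆ independent) (<⇒≱ b<)
      where
      -- The ends of an edge share the label of its colour, which a matching forbids.
      independent : Independent G M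
      independent u v u∈ v∈ e with u ≟ v
      ... | yes refl = ⁅⁆-independent u u u (x∈⁅x⁆ u) (x∈⁅x⁆ u) e
      ... | no u≢v with ≡⊎≡other red (col c u v)
      ... | inj₁ isRed = proj₁ (matching u∈ v∈ u≢v) (label-cong (e , isRed , M⊆ u∈ , M⊆ v∈))
      ... | inj₂ isBlue = proj₂ (matching u∈ v∈ u≢v) (label-cong (e , isBlue , M⊆ u∈ , M⊆ v∈))
    ... | inj₁ (A , B , ≤b , cov) = reds ++ blues , covers , short , All-++⁺
        (All-image⁺ (ball red U r) A λ _ → ball-diam) (All-image⁺ (ball blue U r) B λ _ → ball-diam)
      where
      reds = image (ball red U r) A
      blues = image (ball blue U r) B
      short : length (reds ++ blues) ≤ b
      short rewrite length-++ reds {blues} | length-image (ball red U r) A | length-image (ball blue U r) B = ≤b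
      covers : ∀ {v} → v ∈ U → Any (λ H → v ∈ verts H) (reds ++ blues)
      covers {v} v∈ with cov v∈
      ... | inj₁ a∈ = Any-++⁺ˡ (Any-image⁺ _ a∈ (∈⟪⟫⁺ (near? red U r _) (near-label red v)))
      ... | inj₂ b∈ = Any-++⁺ʳ reds (Any-image⁺ _ b∈ (∈⟪⟫⁺ (near? blue U r _) (near-label blue v)))

  -- Removing balls around an independent set

  module _ (k : Colour) (U : Subset n) (r : ℕ) where

    Reached : Subset n → Fin n → Set
    Reached I v = ∃ λ y → y ∈ I × Near k U r y v

    unreached? : ∀ I → Decidable (λ v → v ∈ U × ¬ Reached I v)
    unreached? I v = v ∈? U ×-dec ¬? (any? λ y → y ∈? I ×-dec near? k U r y v)

    remainder : Subset n → Subset n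
    remainder I = ⟪ unreached? I ⟫

    extend-covering : ∀ {I b} → ∣ I ∣ ≤ b → Covering (remainder I) (b ∸ ∣ I ∣) (r + r) → Covering U b (r + r)
    extend-covering {I} {b} ∣I∣≤b (Hs , covers , short , diam) =
      balls ++ Hs , covers′ , short′ , All-++⁺ (All-image⁺ (ball k U r) I λ _ → ball-diam) diam
      where
      balls = image (ball k U r) I
      short′ : length (balls ++ Hs) ≤ b
      short′ rewrite length-++ balls {Hs} | length-image (ball k U r) I =
        ≤-trans (+-monoʳ-≤ (∣ I ∣) short) (≤-reflexive (m+[n∸m]≡n ∣I∣≤b))
      covers′ : ∀ {v} → v ∈ U → Any (λ H → v ∈ verts H) (balls ++ Hs)
      covers′ {v} v∈ with any? (λ y → y ∈? I ×-dec near? k U r y v)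
      ... | yes (y , y∈ , yv) = Any-++⁺ˡ (Any-image⁺ _ y∈ (∈⟪⟫⁺ (near? k U r y) yv))
      ... | no ¬reached = Any-++⁺ʳ balls (covers (∈⟪⟫⁺ (unreached? I) (v∈ , ¬reached)))

  -- The input for the induction: `∣ I ∣` balls are spent and the independence bound falls by the
  -- same amount; `0 < ∣ I ∣` ensures progress.
  Peel : Colour → Subset n → ℕ → ℕ → Set
  Peel k U r b = ∃ λ I → 0 < ∣ I ∣ × ∣ I ∣ ≤ b × IndependenceBound (remainder k U r I) (b ∸ ∣ I ∣)

  -- Finding a set to peel inside a scattered set

  module _ {k : Colour} {U : Subset n} {r a b : ℕ} (2≤r : 2 ≤ r) (b≤a : b ≤ a) (bound : IndependenceBound U b) where

    -- The vertices of Q lie pairwise at k-distance more than 2, so all edges inside Q have the other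
    -- colour, and every vertex has at most one k-neighbour in Q.
    module _ {Q : Subset n} (Q⊆U : Q ⊆ U) (scattered : D.Scattered {k} {U} adjacent-sym Q) where

      scattered-edge : ∀ {u v} → u ∈ Q → v ∈ Q → Edge G u v → Adj (other k) U u v
      scattered-edge {u} {v} u∈ v∈ e with ≡⊎≡other k (col c u v)
      ... | inj₂ isOther = e , isOther , Q⊆U u∈ , Q⊆U v∈
      ... | inj₁ isK with scattered u∈ v∈ (inj₁ (D.within-edge (e , isK , Q⊆U u∈ , Q⊆U v∈)))
      ... | refl = ⊥-elim (⁅⁆-independent u u u (x∈⁅x⁆ u) (x∈⁅x⁆ u) e)

      -- Otherwise `s` could be added to `I`: an edge between them would have the other colour and
      -- put `s` within distance 1 of `I`.
      reached-by-maximum : ∀ {I} → I ⊆ Q → Independent G I → IndependenceBound Q ∣ I ∣ →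
        ∀ {s} → s ∈ Q → ∃ λ y → y ∈ I × Near (other k) U 1 y s
      reached-by-maximum {I} I⊆ ind max {s} s∈ with any? (λ y → y ∈? I ×-dec near? (other k) U 1 y s)
      ... | yes y = y
      ... | no ¬y = contradiction (max I+s⊆ I+s-ind) (<⇒≱ (≤-reflexive (sym (x∉p⇒∣p∪⁅x⁆∣≡1+∣p∣ I s s∉I))))
        where
        s∉I : s ∉ I
        s∉I s∈I = ¬y (s , s∈I , inj₁ refl)
        I+s⊆ : I ∪ ⁅ s ⁆ ⊆ Q
        I+s⊆ x∈ with x∈p∪q⁻ I ⁅ s ⁆ x∈
        ... | inj₁ x∈I = I⊆ x∈I
        ... | inj₂ x∈s rewrite x∈⁅y⁆⇒x≡y s x∈s = s∈
        I+s-ind : Independent G (I ∪ ⁅ s ⁆)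
        I+s-ind = ∪-independent ind (⁅⁆-independent s) cross
          where
          cross : ∀ {u v} → u ∈ I → v ∈ ⁅ s ⁆ → ¬ Edge G u v
          cross u∈ v∈ e rewrite x∈⁅y⁆⇒x≡y s v∈ = ¬y (_ , u∈ , D.within-edge (scattered-edge (I⊆ u∈) s∈ e))

      -- `J` is the obstruction to peeling off `I`. Passing from `Q` to `kept` loses at most `a`
      -- vertices and brings the independence number below `∣ I ∣`.
      module Reduce {I J : Subset n} (I⊆ : I ⊆ Q) (indI : Independent G I) (maxI : IndependenceBound Q ∣ I ∣)
        (J⊆ : J ⊆ remainder (other k) U r I) (indJ : Independent G J) (large : b ∸ ∣ I ∣ < ∣ J ∣) where

        HasNeighbour : Fin n → Set
        HasNeighbour q = ∃ λ j → j ∈ J × Adj k U j q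

        hasNeighbour? : Decidable HasNeighbour
        hasNeighbour? q = any? λ j → j ∈? J ×-dec adj? k U j q

        hit? : Decidable (λ q → q ∈ Q × HasNeighbour q)
        hit? q = q ∈? Q ×-dec hasNeighbour? q

        kept? : Decidable (λ q → q ∈ Q × ¬ HasNeighbour q)
        kept? q = q ∈? Q ×-dec ¬? (hasNeighbour? q)

        hit kept : Subset n
        hit = ⟪ hit? ⟫
        kept = ⟪ kept? ⟫

        kept⊆Q : kept ⊆ Q
        kept⊆Q q∈ = proj₁ (∈⟪⟫⁻ kept? q∈)

        J⊆U : J ⊆ U
        J⊆U j∈ = proj₁ (∈⟪⟫⁻ (unreached? (other k) U r I) (J⊆ j∈))

        ∣Q∣≤∣kept∣+a : ∣ Q ∣ ≤ ∣ kept ∣ + a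
        ∣Q∣≤∣kept∣+a = begin
          ∣ Q ∣               ≤⟨ p⊆q⇒∣p∣≤∣q∣ split ⟩
          ∣ kept ∪ hit ∣      ≤⟨ ∣p∪q∣≤∣p∣+∣q∣ kept hit ⟩
          ∣ kept ∣ + ∣ hit ∣  ≤⟨ +-monoʳ-≤ (∣ kept ∣) few ⟩
          ∣ kept ∣ + ∣ J ∣    ≤⟨ +-monoʳ-≤ (∣ kept ∣) (≤-trans (bound J⊆U indJ) b≤a) ⟩
          ∣ kept ∣ + a        ∎
          where
          open ≤-Reasoning
          split : Q ⊆ kept ∪ hit
          split {q} q∈ with hasNeighbour? q
          ... | yes h = x∈p∪q⁺ (inj₂ (∈⟪⟫⁺ hit? (q∈ , h)))
          ... | no ¬h = x∈p∪q⁺ (inj₁ (∈⟪⟫⁺ kept? (q∈ , ¬h)))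
          few : ∣ hit ∣ ≤ ∣ J ∣
          -- Two vertices of `Q` with a common `k`-neighbour are within distance 2, hence equal; so
          -- each `j` hits at most one.
          few = functional⇒∣T∣≤∣S∣ J hit (adj? k U) (λ q∈ → proj₂ (∈⟪⟫⁻ hit? q∈)) λ p∈ q∈ jp jq →
            scattered (proj₁ (∈⟪⟫⁻ hit? p∈)) (proj₁ (∈⟪⟫⁻ hit? q∈))
              (D.within-trans 1 (D.within-edge (adjacent-sym jp)) (D.within-edge jq))

        -- If `S` had at least `∣ I ∣` elements, `S ∪ J` would be an independent subset of `U` with
        -- more than `b`.
        kept-bound : ∀ {S} → S ⊆ kept → Independent G S → ∣ S ∣ < ∣ I ∣
        kept-bound {S} S⊆ indS = ≰⇒> λ ∣I∣≤∣S∣ → <⇒≱ (exceeds ∣I∣≤∣S∣) (bound S∪J⊆U (∪-independent indS indJ cross))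
          where
          reach : ∀ {s} → s ∈ S → ∃ λ y → y ∈ I × Near (other k) U 1 y s
          reach s∈ = reached-by-maximum I⊆ indI maxI (kept⊆Q (S⊆ s∈))
          ¬reached : ∀ {j} → j ∈ J → ¬ Reached (other k) U r I j
          ¬reached j∈ = proj₂ (∈⟪⟫⁻ (unreached? (other k) U r I) (J⊆ j∈))
          cross : ∀ {s j} → s ∈ S → j ∈ J → ¬ Edge G s j
          cross {s} {j} s∈ j∈ e with ≡⊎≡other k (col c s j)
          ... | inj₁ isK = proj₂ (∈⟪⟫⁻ kept? (S⊆ s∈)) (j , j∈ , adjacent-sym (e , isK , Q⊆U (kept⊆Q (S⊆ s∈)) , J⊆U j∈))
          -- An edge of the other colour would put `j` within distance 2 of `I`, inside a removed
          -- ball because `2 ≤ r`.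
          ... | inj₂ isOther = let y , y∈ , ys = reach s∈ in ¬reached j∈
            (y , y∈ , D.within-mono 2≤r (D.within-trans 1 ys (D.within-edge (e , isOther , Q⊆U (kept⊆Q (S⊆ s∈)) , J⊆U j∈))))
          disjoint : ∀ x → x ∈ S → x ∉ J
          disjoint x x∈S x∈J = let y , y∈ , yx = reach x∈S in ¬reached x∈J (y , y∈ , D.within-mono (<⇒≤ 2≤r) yx)
          S∪J⊆U : S ∪ J ⊆ U
          S∪J⊆U x∈ with x∈p∪q⁻ S J x∈
          ... | inj₁ x∈S = Q⊆U (kept⊆Q (S⊆ x∈S))
          ... | inj₂ x∈J = J⊆U x∈J
          exceeds : ∣ I ∣ ≤ ∣ S ∣ → b < ∣ S ∪ J ∣
          exceeds ∣I∣≤∣S∣ = begin-strict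
            b                      ≡⟨ m+[n∸m]≡n (bound (λ x∈ → Q⊆U (I⊆ x∈)) indI) ⟨
            ∣ I ∣ + (b ∸ ∣ I ∣)    <⟨ +-monoʳ-< (∣ I ∣) large ⟩
            ∣ I ∣ + ∣ J ∣          ≤⟨ +-monoˡ-≤ (∣ J ∣) ∣I∣≤∣S∣ ⟩
            ∣ S ∣ + ∣ J ∣          ≡⟨ disjoint⇒∣p∪q∣≡∣p∣+∣q∣ S J disjoint ⟨
            ∣ S ∪ J ∣              ∎
            where open ≤-Reasoning

    -- Induction on the independence bound `s` of `Q`. A failed round lowers `s` by one and costs at
    -- most `a` vertices, which preserves `s * a < ∣ Q ∣`; at `s = 0` the nonempty `Q` is a
    -- contradiction.
    peel : ∀ s {Q} → Q ⊆ U → D.Scattered {k} {U} adjacent-sym Q → IndependenceBound Q s → s * a < ∣ Q ∣ →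
      Peel (other k) U r b
    peel zero {Q} _ _ none 0<∣Q∣ = contradiction (empty⇒∣p∣≡0 Q-empty) (>⇒≢ 0<∣Q∣)
      where
      Q-empty : ∀ q → q ∉ Q
      Q-empty q q∈ = contradiction (none single (⁅⁆-independent q)) (<⇒≱ (≤-reflexive (sym (∣⁅x⁆∣≡1 q))))
        where
        single : ⁅ q ⁆ ⊆ Q
        single x∈ rewrite x∈⁅y⁆⇒x≡y q x∈ = q∈
    peel (suc s) {Q} Q⊆U scattered maxQ large with independence-dichotomy Q s
    ... | inj₁ maxQ′ = peel s Q⊆U scattered maxQ′ (≤-<-trans (m≤n+m (s * a) a) large)
    -- `maxQ` bounds `∣ I ∣` by `suc s`, so `I` is a maximum independent subset of `Q`.
    ... | inj₂ (I , I⊆ , indI , s<∣I∣) with independence-dichotomy (remainder (other k) U r I) (b ∸ ∣ I ∣)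
    ... | inj₁ rest = I , ≤-<-trans z≤n s<∣I∣ , bound (λ x∈ → Q⊆U (I⊆ x∈)) indI , rest
    ... | inj₂ (J , J⊆ , indJ , largeJ) = peel s (λ x∈ → Q⊆U (kept⊆Q x∈))
      (λ p∈ q∈ → scattered (kept⊆Q p∈) (kept⊆Q q∈))
      (λ S⊆ indS → ≤-pred (≤-trans (kept-bound S⊆ indS) (maxQ I⊆ indI)))
      (+-cancelˡ-< a _ _ (<-≤-trans large (≤-trans ∣Q∣≤∣kept∣+a (≤-reflexive (+-comm _ a)))))
      where open Reduce Q⊆U scattered I⊆ indI (λ S⊆ indS → ≤-trans (maxQ S⊆ indS) s<∣I∣) J⊆ indJ largeJ

    -- Depth `r + 1` has room for `a * a + 1` layers spaced by three, and `b * a < a * a + 1` lets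
    -- `peel` start at `s = b`.
    layer⇒peel : (suc (a * a)) * 3 ≤ suc r → ∀ {u v} → D.Layer {k} {U} (suc r) u v → Peel (other k) U r b
    layer⇒peel long {u} {v} l = peel b Q⊆U scattered (λ S⊆ → bound (λ x∈ → Q⊆U (S⊆ x∈)))
      (≤-trans (s≤s (*-monoˡ-≤ a b≤a)) (≤-reflexive (sym ∣Q∣≡)))
      where
      l′ : D.Layer {k} {U} ((suc r ∸ suc (a * a) * 3) + suc (a * a) * 3) u v
      l′ = subst (λ i → D.Layer {k} {U} i u v) (sym (m∸n+n≡m long)) l
      spread = D.scattered-set {k} {U} adjacent-sym (suc (a * a)) (proj₂ (D.layer-below (suc r ∸ suc (a * a) * 3) l′))
      Q : Subset n
      Q = proj₁ spread
      scattered = proj₁ (proj₂ (proj₂ spread))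
      ∣Q∣≡ : ∣ Q ∣ ≡ suc (a * a)
      ∣Q∣≡ = proj₂ (proj₂ (proj₂ spread))
      Q⊆U : Q ⊆ U
      Q⊆U q∈ = let _ , _ , _ , _ , _ , q∈U = proj₁ (proj₂ spread) q∈ in q∈U

  -- The induction on the independence bound

  module _ {r a : ℕ} (2≤r : 2 ≤ r) (long : suc (a * a) * 3 ≤ suc r) where

    stable-or-layer : ∀ U k → (∀ {u v} → Near k U (suc r) u v → Near k U r u v) ⊎ ∃₂ (D.Layer {k} {U} (suc r))
    stable-or-layer U k with any? (λ u → any? λ v → near? k U (suc r) u v ×-dec ¬? (near? k U r u v))
    ... | yes (u , v , p , ¬q) = inj₂ (u , v , D.layer-of-within p ¬q)
    ... | no ¬uv = inj₁ λ {u} {v} p → decidable-stable (near? k U r u v) λ ¬q → ¬uv (u , v , p , ¬q)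

    layer⇒covering : ∀ {k U b} → b ≤ a → IndependenceBound U b → ∃₂ (D.Layer {k} {U} (suc r)) →
      (∀ {b′} → b′ < b → ∀ U′ → IndependenceBound U′ b′ → Covering U′ b′ (r + r)) → Covering U b (r + r)
    layer⇒covering {k} {U} {b} b≤a bound (_ , _ , l) rec = extend (layer⇒peel 2≤r b≤a bound long l)
      where
      extend : Peel (other k) U r b → Covering U b (r + r)
      extend (I , 0<∣I∣ , ∣I∣≤b , rest) = extend-covering (other k) U r ∣I∣≤b
        (rec (∸-monoʳ-< 0<∣I∣ ∣I∣≤b) (remainder (other k) U r I) rest)

    -- `b` decreases with each peeling while `a`, and with it the radius, stays fixed.
    covering : ∀ {b} → Acc _<_ b → b ≤ a → ∀ U → IndependenceBound U b → Covering U b (r + r)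
    covering {b} (acc rec) b≤a U bound = cases (stable-or-layer U red) (stable-or-layer U blue)
      where
      recurse : ∀ {k} → ∃₂ (D.Layer {k} {U} (suc r)) → Covering U b (r + r)
      recurse l = layer⇒covering b≤a bound l λ b′<b → covering (rec b′<b) (≤-trans (<⇒≤ b′<b) b≤a)

      cases : (∀ {u v} → Near red U (suc r) u v → Near red U r u v) ⊎ ∃₂ (D.Layer {red} {U} (suc r)) →
        (∀ {u v} → Near blue U (suc r) u v → Near blue U r u v) ⊎ ∃₂ (D.Layer {blue} {U} (suc r)) →
        Covering U b (r + r)
      cases (inj₂ l) _ = recurse l
      cases (inj₁ _) (inj₂ l) = recurse l
      cases (inj₁ stableʳ) (inj₁ stableᵇ) = component-covering (λ { red → stableʳ ; blue → stableᵇ }) bound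

theorem3 : ∀ (n : ℕ) (G : Graph n) (c : Colouring G) (a : ℕ) →
    IsIndependenceNumber G a →
    Σ (List (MonoSubgraph G c)) λ Hs →
    Covers Hs × length Hs ≤ a ×
    All (λ H → DiamLe H (8 * (a * a) + 12 * a + 4)) Hs
theorem3 n G c a (_ , maximal) =
  let Hs , covers , short , diam = covering 2≤r long (<-wellFounded a) ≤-refl ⊤ (λ _ → maximal _)
  in Hs , (λ _ → covers ∈⊤) , short , subst (λ D → All (λ H → DiamLe H D) Hs) (diameter a) diam
  where
  open MonochromaticBalls G c
  open +-*-Solver
  -- Half of the required diameter.
  r : ℕ
  r = 4 * (a * a) + 6 * a + 2
  2≤r : 2 ≤ r
  2≤r = m≤n+m 2 _
  -- The deepest layer used, `3a² + 3`, lies `a² + 6a` below `r + 1 = 4a² + 6a + 3`.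
  long : suc (a * a) * 3 ≤ suc r
  long = ≤-trans (m≤m+n _ (a * a + 6 * a)) (≤-reflexive (slack a))
    where
    slack : ∀ a → suc (a * a) * 3 + (a * a + 6 * a) ≡ suc (4 * (a * a) + 6 * a + 2)
    slack = solve 1 (λ a → (con 1 :+ a :* a) :* con 3 :+ (a :* a :+ con 6 :* a)
                        := con 1 :+ (con 4 :* (a :* a) :+ con 6 :* a :+ con 2)) refl
  diameter : ∀ a → (4 * (a * a) + 6 * a + 2) + (4 * (a * a) + 6 * a + 2) ≡ 8 * (a * a) + 12 * a + 4
  diameter = solve 1 (λ a → (con 4 :* (a :* a) :+ con 6 :* a :+ con 2) :+ (con 4 :* (a :* a) :+ con 6 :* a :+ con 2)
                         := con 8 :* (a :* a) :+ con 12 :* a :+ con 4) refl
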